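{- Let $\lambda\in\mathbb{R}$ and $r\in\mathbb{N}\cup\{0\}$. For all integers $n,k\ge0$, $$\frac{1}{k!}\sum_{m=0}^{n}\lambda^{n-m}S_1(n,m)\,\Delta^k r^m=\begin{cases}0&\text{if } n<k,\\ S_{2,r}(n+r,k+r|\lambda)&\text{if } n\ge k.\end{cases}$$
   Context: All generating functions are formal power series in $t$. For a number $y$, $(1+\lambda t)^{y/\lambda}$ denotes the formal power series $\sum_{n\ge0}(y|\lambda)_n\frac{t^n}{n!}$, where $(y|\lambda)_0=1$ and $(y|\lambda)_n=y(y-\lambda)(y-2\lambda)\cdots(y-(n-1)\lambda)$ for $n\ge1$ (for $\lambda=0$ this is the limit $e^{yt}$). The convention $0^0=1$ is used. $\Delta$ is the forward difference operator $\Delta f(x)=f(x+1)-f(x)$, and $\Delta^k r^m$ denotes $\Delta^k$ applied to the function $f(x)=x^m$ and evaluated at $x=r$, i.e. $\Delta^k r^m=\sum_{l=0}^k\binom{k}{l}(-1)^{k-l}(l+r)^m$. The (signed) Stirling numbers of the first kind $S_1(n,k)$ are defined by $(x)_n=\sum_{k=0}^n S_1(n,k)x^k$, where $(x)_0=1$ and $(x)_n=x(x-1)\cdots(x-n+1)$ for $n\ge1$. The extended degenerate Stirling numbers of the second kind $S_{2,r}(n+r,k+r|\lambda)$ are defined, for $r,k\in\mathbb{N}\cup\{0\}$, by $$\frac{1}{k!}(1+\lambda t)^{r/\lambda}\left((1+\lambda t)^{1/\lambda}-1\right)^k=\sum_{n=k}^\infty S_{2,r}(n+r,k+r|\lambda)\frac{t^n}{n!}.$$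 -}

module Defs where

open import Algebra.Bundles using (CommutativeRing)
import Algebra.Properties.Semiring.Exp as SemiringExp
import Algebra.Properties.Semiring.Mult as SemiringMult
import Algebra.Properties.Semiring.Sum as SemiringSum
open import Algebra.Morphism.Structures using (IsRingHomomorphism)
open import Data.Fin.Base using (toℕ)
import Data.Integer.Base as ℤ
open import Data.Nat.Base as ℕ using (ℕ; zero; suc; _∸_; _!)
import Data.Nat.Properties as ℕ
open import Data.Nat.Properties using (_!≢0)
open import Data.Product.Base using (∃-syntax; _,_; proj₁; proj₂)
open import Data.Rational.Base as ℚ using (ℚ; 0ℚ; 1ℚ; ½)
import Data.Rational.Properties as ℚ
open import Data.Rational.Solver using (module +-*-Solver)
open import Level using (0ℓ)
open import Relation.Binary.PropositionalEquality.Core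
  using (_≡_; refl; sym; trans; cong; subst)

------------------------------------------------------------------------
-- The real numbers: Cauchy sequences of rationals, two of them being
-- equal when their difference tends to 0.

private
  variable
    p p′ q q′ B ε : ℚ

IsCauchy : (ℕ → ℚ) → Set
IsCauchy x = ∀ ε → 0ℚ ℚ.< ε →
  ∃[ N ] (∀ m n → N ℕ.≤ m → N ℕ.≤ n → ℚ.∣ x m ℚ.- x n ∣ ℚ.< ε)

record ℝ : Set where
  constructor mkℝ
  field
    seq    : ℕ → ℚ
    cauchy : IsCauchy seq

open ℝ public

infix 4 _≈ᴿ_

record _≈ᴿ_ (x y : ℝ) : Set where
  constructor mk≈
  field
    close : ∀ ε → 0ℚ ℚ.< ε →
      ∃[ N ] (∀ n → N ℕ.≤ n → ℚ.∣ seq x n ℚ.- seq y n ∣ ℚ.< ε)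

open _≈ᴿ_ public

private
  half : ℚ → ℚ
  half ε = ε ℚ.* ½

  half-pos : 0ℚ ℚ.< ε → 0ℚ ℚ.< half ε
  half-pos 0<ε = ℚ.*-monoˡ-<-pos ½ 0<ε

  half+half : ∀ ε → half ε ℚ.+ half ε ≡ ε
  half+half ε = trans (sym (ℚ.*-distribˡ-+ ε ½ ½)) (ℚ.*-identityʳ ε)

  <-halves : p ℚ.≤ q ℚ.+ q′ → q ℚ.< half ε → q′ ℚ.< half ε → p ℚ.< ε
  <-halves {ε = ε} p≤ q< q′< =
    ℚ.≤-<-trans p≤ (subst (_ ℚ.<_) (half+half ε) (ℚ.+-mono-< q< q′<))

  split : ∀ p q {z} → p ℚ.+ q ≡ z → ℚ.∣ z ∣ ℚ.≤ ℚ.∣ p ∣ ℚ.+ ℚ.∣ q ∣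
  split p q refl = ℚ.∣p+q∣≤∣p∣+∣q∣ p q

  ∣p-p∣<ε : ∀ p → 0ℚ ℚ.< ε → ℚ.∣ p ℚ.- p ∣ ℚ.< ε
  ∣p-p∣<ε p 0<ε = subst (ℚ._< _) (sym (cong ℚ.∣_∣ (ℚ.+-inverseʳ p))) 0<ε

  ∣-∣-comm : ∀ p q → ℚ.∣ p ℚ.- q ∣ ≡ ℚ.∣ q ℚ.- p ∣
  ∣-∣-comm p q = trans (sym (ℚ.∣-p∣≡∣p∣ (p ℚ.- q)))
    (cong ℚ.∣_∣ (solve 2 (λ p q → :- (p :- q) := q :- p) refl p q))
    where open +-*-Solver

  ∣-∣-triangle : ∀ p q r → ℚ.∣ p ℚ.- r ∣ ℚ.≤ ℚ.∣ p ℚ.- q ∣ ℚ.+ ℚ.∣ q ℚ.- r ∣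
  ∣-∣-triangle p q r = split (p ℚ.- q) (q ℚ.- r)
    (solve 3 (λ p q r → (p :- q) :+ (q :- r) := p :- r) refl p q r)
    where open +-*-Solver

  neg-close : ∀ p p′ → ℚ.∣ p ℚ.- p′ ∣ ℚ.< ε → ℚ.∣ ℚ.- p ℚ.- ℚ.- p′ ∣ ℚ.< ε
  neg-close p p′ = subst (ℚ._< _)
    (trans (∣-∣-comm p p′)
      (cong ℚ.∣_∣ (solve 2 (λ p p′ → p′ :- p := :- p :- :- p′) refl p p′)))
    where open +-*-Solver

  +-close : ∀ p p′ q q′ →
    ℚ.∣ p ℚ.- p′ ∣ ℚ.< half ε → ℚ.∣ q ℚ.- q′ ∣ ℚ.< half ε →
    ℚ.∣ (p ℚ.+ q) ℚ.- (p′ ℚ.+ q′) ∣ ℚ.< ε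
  +-close p p′ q q′ = <-halves (split (p ℚ.- p′) (q ℚ.- q′)
    (solve 4 (λ p p′ q q′ → (p :- p′) :+ (q :- q′) := (p :+ q) :- (p′ :+ q′))
      refl p p′ q q′))
    where open +-*-Solver

  over : ∀ B → 0ℚ ℚ.< B → ℚ → ℚ
  over B 0<B ε = (ℚ.1/ B) {{ℚ.pos⇒nonZero B {{ℚ.positive 0<B}}}} ℚ.* ε

  over-pos : ∀ B (0<B : 0ℚ ℚ.< B) → 0ℚ ℚ.< ε → 0ℚ ℚ.< over B 0<B ε
  over-pos {ε} B 0<B 0<ε =
    subst (ℚ._< (1/B ℚ.* ε)) (ℚ.*-zeroʳ 1/B) (ℚ.*-monoʳ-<-pos 1/B {{1/B-pos}} 0<ε)
    where
    1/B = (ℚ.1/ B) {{ℚ.pos⇒nonZero B {{ℚ.positive 0<B}}}}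
    1/B-pos = ℚ.1/pos⇒pos B {{ℚ.positive 0<B}}

  *-small : ∀ p q (0<B : 0ℚ ℚ.< B) →
    ℚ.∣ p ∣ ℚ.< B → ℚ.∣ q ∣ ℚ.< over B 0<B ε → ℚ.∣ p ℚ.* q ∣ ℚ.< ε
  *-small {B} {ε} p q 0<B p<B q< = begin-strict
    ℚ.∣ p ℚ.* q ∣          ≡⟨ ℚ.∣p*q∣≡∣p∣*∣q∣ p q ⟩
    ℚ.∣ p ∣ ℚ.* ℚ.∣ q ∣    ≤⟨ ℚ.*-monoʳ-≤-nonNeg ℚ.∣ q ∣ {{ℚ.∣-∣-nonNeg q}} (ℚ.<⇒≤ p<B) ⟩
    B ℚ.* ℚ.∣ q ∣          <⟨ ℚ.*-monoʳ-<-pos B {{ℚ.positive 0<B}} q< ⟩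
    B ℚ.* over B 0<B ε     ≡⟨ ℚ.*-assoc B _ ε ⟨
    B ℚ.* _ ℚ.* ε          ≡⟨ cong (ℚ._* ε) (ℚ.*-inverseʳ B {{B≢0}}) ⟩
    1ℚ ℚ.* ε               ≡⟨ ℚ.*-identityˡ ε ⟩
    ε                      ∎
    where
    open ℚ.≤-Reasoning
    B≢0 = ℚ.pos⇒nonZero B {{ℚ.positive 0<B}}

  *-close : ∀ {A} p p′ q q′ (0<A : 0ℚ ℚ.< A) (0<B : 0ℚ ℚ.< B) →
    ℚ.∣ p ∣ ℚ.< A → ℚ.∣ q′ ∣ ℚ.< B →
    ℚ.∣ q ℚ.- q′ ∣ ℚ.< over A 0<A (half ε) →
    ℚ.∣ p ℚ.- p′ ∣ ℚ.< over B 0<B (half ε) →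
    ℚ.∣ p ℚ.* q ℚ.- p′ ℚ.* q′ ∣ ℚ.< ε
  *-close p p′ q q′ 0<A 0<B p<A q′<B dq dp = <-halves
    (split (p ℚ.* (q ℚ.- q′)) (q′ ℚ.* (p ℚ.- p′))
      (solve 4 (λ p p′ q q′ →
        p :* (q :- q′) :+ q′ :* (p :- p′) := p :* q :- p′ :* q′) refl p p′ q q′))
    (*-small p (q ℚ.- q′) 0<A p<A dq)
    (*-small q′ (p ℚ.- p′) 0<B q′<B dp)
    where open +-*-Solver

  bound-from : ℝ → ℕ
  bound-from x = proj₁ (cauchy x 1ℚ (ℚ.positive⁻¹ 1ℚ))

  bound : ℝ → ℚ
  bound x = 1ℚ ℚ.+ ℚ.∣ seq x (bound-from x) ∣

  bound-pos : ∀ x → 0ℚ ℚ.< bound x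
  bound-pos x = ℚ.+-mono-<-≤ (ℚ.positive⁻¹ 1ℚ) (ℚ.0≤∣p∣ (seq x (bound-from x)))

  bounded : ∀ x n → bound-from x ℕ.≤ n → ℚ.∣ seq x n ∣ ℚ.< bound x
  bounded x n N≤n = ℚ.≤-<-trans
    (split (seq x n ℚ.- xN) xN
      (solve 2 (λ p q → (p :- q) :+ q := p) refl (seq x n) xN))
    (ℚ.+-monoˡ-< ℚ.∣ xN ∣
      (proj₂ (cauchy x 1ℚ (ℚ.positive⁻¹ 1ℚ)) n (bound-from x) N≤n ℕ.≤-refl))
    where
    open +-*-Solver
    xN = seq x (bound-from x)

  ⊔-l : ∀ a b {n} → a ℕ.⊔ b ℕ.≤ n → a ℕ.≤ n
  ⊔-l a b = ℕ.≤-trans (ℕ.m≤m⊔n a b)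

  ⊔-r : ∀ a b {n} → a ℕ.⊔ b ℕ.≤ n → b ℕ.≤ n
  ⊔-r a b = ℕ.≤-trans (ℕ.m≤n⊔m a b)

fromℚᴿ : ℚ → ℝ
fromℚᴿ p = mkℝ (λ _ → p) (λ ε 0<ε → 0 , λ _ _ _ _ → ∣p-p∣<ε p 0<ε)

infixl 6 _+ᴿ_
infixl 7 _*ᴿ_
infix  8 -ᴿ_

_+ᴿ_ : ℝ → ℝ → ℝ
seq    (x +ᴿ y) n = seq x n ℚ.+ seq y n
cauchy (x +ᴿ y) ε 0<ε
  with cauchy x (half ε) (half-pos 0<ε) | cauchy y (half ε) (half-pos 0<ε)
... | M , cx | N , cy = M ℕ.⊔ N , λ m n ≤m ≤n →
  +-close (seq x m) (seq x n) (seq y m) (seq y n)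
    (cx m n (⊔-l M N ≤m) (⊔-l M N ≤n))
    (cy m n (⊔-r M N ≤m) (⊔-r M N ≤n))

-ᴿ_ : ℝ → ℝ
seq    (-ᴿ x) n = ℚ.- seq x n
cauchy (-ᴿ x) ε 0<ε with cauchy x ε 0<ε
... | N , cx = N , λ m n ≤m ≤n → neg-close (seq x m) (seq x n) (cx m n ≤m ≤n)

_*ᴿ_ : ℝ → ℝ → ℝ
seq    (x *ᴿ y) n = seq x n ℚ.* seq y n
cauchy (x *ᴿ y) ε 0<ε
  with cauchy y _ (over-pos (bound x) (bound-pos x) (half-pos 0<ε))
     | cauchy x _ (over-pos (bound y) (bound-pos y) (half-pos 0<ε))
... | M , cy | N , cx = (K ℕ.⊔ L) ℕ.⊔ (M ℕ.⊔ N) , λ m n ≤m ≤n →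
  *-close (seq x m) (seq x n) (seq y m) (seq y n) (bound-pos x) (bound-pos y)
    (bounded x m (⊔-l K L (⊔-l (K ℕ.⊔ L) (M ℕ.⊔ N) ≤m)))
    (bounded y n (⊔-r K L (⊔-l (K ℕ.⊔ L) (M ℕ.⊔ N) ≤n)))
    (cy m n (⊔-l M N (⊔-r (K ℕ.⊔ L) (M ℕ.⊔ N) ≤m))
            (⊔-l M N (⊔-r (K ℕ.⊔ L) (M ℕ.⊔ N) ≤n)))
    (cx m n (⊔-r M N (⊔-r (K ℕ.⊔ L) (M ℕ.⊔ N) ≤m))
            (⊔-r M N (⊔-r (K ℕ.⊔ L) (M ℕ.⊔ N) ≤n)))
  where
  K = bound-from x
  L = bound-from y

private
  pointwise : ∀ {x y} → (∀ n → seq x n ≡ seq y n) → x ≈ᴿ y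
  pointwise {x} {y} x≗y = mk≈ λ ε 0<ε → 0 , λ n _ →
    subst (λ z → ℚ.∣ seq x n ℚ.- z ∣ ℚ.< ε) (x≗y n) (∣p-p∣<ε (seq x n) 0<ε)

  ≈-sym : ∀ {x y} → x ≈ᴿ y → y ≈ᴿ x
  ≈-sym {x} {y} x≈y = mk≈ λ ε 0<ε → let N , c = close x≈y ε 0<ε in
    N , λ n N≤n → subst (ℚ._< ε) (∣-∣-comm (seq x n) (seq y n)) (c n N≤n)

  ≈-trans : ∀ {x y z} → x ≈ᴿ y → y ≈ᴿ z → x ≈ᴿ z
  ≈-trans {x} {y} {z} x≈y y≈z = mk≈ λ ε 0<ε →
    let M , c = close x≈y (half ε) (half-pos 0<ε)
        N , d = close y≈z (half ε) (half-pos 0<ε)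
    in M ℕ.⊔ N , λ n ≤n →
      <-halves (∣-∣-triangle (seq x n) (seq y n) (seq z n))
        (c n (⊔-l M N ≤n)) (d n (⊔-r M N ≤n))

  +-cong : ∀ {x x′ y y′} → x ≈ᴿ x′ → y ≈ᴿ y′ → x +ᴿ y ≈ᴿ x′ +ᴿ y′
  +-cong {x} {x′} {y} {y′} x≈ y≈ = mk≈ λ ε 0<ε →
    let M , c = close x≈ (half ε) (half-pos 0<ε)
        N , d = close y≈ (half ε) (half-pos 0<ε)
    in M ℕ.⊔ N , λ n ≤n →
      +-close (seq x n) (seq x′ n) (seq y n) (seq y′ n)
        (c n (⊔-l M N ≤n)) (d n (⊔-r M N ≤n))

  neg-cong : ∀ {x x′} → x ≈ᴿ x′ → -ᴿ x ≈ᴿ -ᴿ x′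
  neg-cong {x} {x′} x≈ = mk≈ λ ε 0<ε → let N , c = close x≈ ε 0<ε in
    N , λ n ≤n → neg-close (seq x n) (seq x′ n) (c n ≤n)

  *-cong : ∀ {x x′ y y′} → x ≈ᴿ x′ → y ≈ᴿ y′ → x *ᴿ y ≈ᴿ x′ *ᴿ y′
  *-cong {x} {x′} {y} {y′} x≈ y≈ = mk≈ λ ε 0<ε →
    let M , d = close y≈ _ (over-pos (bound x)  (bound-pos x)  (half-pos 0<ε))
        N , c = close x≈ _ (over-pos (bound y′) (bound-pos y′) (half-pos 0<ε))
        K = bound-from x
        L = bound-from y′
    in (K ℕ.⊔ L) ℕ.⊔ (M ℕ.⊔ N) , λ n ≤n →
      *-close (seq x n) (seq x′ n) (seq y n) (seq y′ n) (bound-pos x) (bound-pos y′)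
        (bounded x  n (⊔-l K L (⊔-l (K ℕ.⊔ L) (M ℕ.⊔ N) ≤n)))
        (bounded y′ n (⊔-r K L (⊔-l (K ℕ.⊔ L) (M ℕ.⊔ N) ≤n)))
        (d n (⊔-l M N (⊔-r (K ℕ.⊔ L) (M ℕ.⊔ N) ≤n)))
        (c n (⊔-r M N (⊔-r (K ℕ.⊔ L) (M ℕ.⊔ N) ≤n)))

ℝ-commutativeRing : CommutativeRing 0ℓ 0ℓ
ℝ-commutativeRing = record
  { Carrier = ℝ
  ; _≈_ = _≈ᴿ_
  ; _+_ = _+ᴿ_
  ; _*_ = _*ᴿ_
  ; -_  = -ᴿ_
  ; 0#  = fromℚᴿ 0ℚ
  ; 1#  = fromℚᴿ 1ℚ
  ; isCommutativeRing = record
    { isRing = record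
      { +-isAbelianGroup = record
        { isGroup = record
          { isMonoid = record
            { isSemigroup = record
              { isMagma = record
                { isEquivalence = record
                  { refl  = pointwise λ _ → refl
                  ; sym   = ≈-sym
                  ; trans = ≈-trans
                  }
                ; ∙-cong = +-cong
                }
              ; assoc = λ x y z → pointwise λ n → ℚ.+-assoc (seq x n) (seq y n) (seq z n)
              }
            ; identity = (λ x → pointwise λ n → ℚ.+-identityˡ (seq x n))
                       , (λ x → pointwise λ n → ℚ.+-identityʳ (seq x n))
            }
          ; inverse = (λ x → pointwise λ n → ℚ.+-inverseˡ (seq x n))
                    , (λ x → pointwise λ n → ℚ.+-inverseʳ (seq x n))
          ; ⁻¹-cong = neg-cong
          }
        ; comm = λ x y → pointwise λ n → ℚ.+-comm (seq x n) (seq y n)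
        }
      ; *-cong = *-cong
      ; *-assoc = λ x y z → pointwise λ n → ℚ.*-assoc (seq x n) (seq y n) (seq z n)
      ; *-identity = (λ x → pointwise λ n → ℚ.*-identityˡ (seq x n))
                   , (λ x → pointwise λ n → ℚ.*-identityʳ (seq x n))
      ; distrib = (λ x y z → pointwise λ n → ℚ.*-distribˡ-+ (seq x n) (seq y n) (seq z n))
                , (λ x y z → pointwise λ n → ℚ.*-distribʳ-+ (seq x n) (seq y n) (seq z n))
      }
    ; *-comm = λ x y → pointwise λ n → ℚ.*-comm (seq x n) (seq y n)
    }
  }

fromℚᴿ-isRingHomomorphism :
  IsRingHomomorphism ℚ.+-*-rawRing (CommutativeRing.rawRing ℝ-commutativeRing) fromℚᴿ
fromℚᴿ-isRingHomomorphism = record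
  { isSemiringHomomorphism = record
    { isNearSemiringHomomorphism = record
      { +-isMonoidHomomorphism = record
        { isMagmaHomomorphism = record
          { isRelHomomorphism = record
            { cong = λ p≡q → pointwise λ _ → p≡q }
          ; homo = λ _ _ → pointwise λ _ → refl
          }
        ; ε-homo = pointwise λ _ → refl
        }
      ; *-homo = λ _ _ → pointwise λ _ → refl
      }
    ; 1#-homo = pointwise λ _ → refl
    }
  ; -‿homo = λ _ → pointwise λ _ → refl
  }

------------------------------------------------------------------------
-- The definitions below use only that the scalars form a commutative
-- ℚ-algebra.

module DegenerateStirling
  {c ℓ} (R : CommutativeRing c ℓ)
  (fromℚ : ℚ → CommutativeRing.Carrier R)
  (fromℚ-isRingHomomorphism :
    IsRingHomomorphism ℚ.+-*-rawRing (CommutativeRing.rawRing R) fromℚ)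
  where

  open CommutativeRing R hiding (zero; refl; sym; trans)
  open SemiringExp semiring public using (_^_)
  open SemiringMult semiring using (_×_)
  open SemiringSum semiring public using (sum⁺-syntax)

  fromℕ : ℕ → Carrier
  fromℕ n = n × 1#

  1/_! : ℕ → Carrier
  1/ n ! = fromℚ ((ℤ.+ 1) ℚ./ (n !))
    where instance _ = n !≢0

  -- A formal power series, as its sequence of ordinary coefficients:
  -- f n is the coefficient of tⁿ (not of tⁿ/n!).
  Series : Set c
  Series = ℕ → Carrier

  infixl 6 _⊖_
  infixl 7 _⊛_ _•_

  constant : Carrier → Series
  constant a zero    = a
  constant a (suc _) = 0#

  indeterminate : Series
  indeterminate (suc zero) = 1#
  indeterminate _          = 0#

  _⊖_ : Series → Series → Series
  (f ⊖ g) n = f n - g n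

  _•_ : Carrier → Series → Series
  (a • f) n = a * f n

  _⊛_ : Series → Series → Series
  (f ⊛ g) n = ∑[ i ≤ n ] (f (toℕ i) * g (n ∸ toℕ i))

  power : Series → ℕ → Series
  power f zero    = constant 1#
  power f (suc k) = f ⊛ power f k

  degenerateFalling : Carrier → Carrier → ℕ → Carrier
  degenerateFalling y μ zero    = 1#
  degenerateFalling y μ (suc n) =
    degenerateFalling y μ n * (y - fromℕ n * μ)

  -- (1 + μ t)^{y/μ}, being e^{yt} for μ = 0.  The parameter usually called
  -- λ is named μ, since λ is reserved.
  degenerateExp : Carrier → Carrier → Series
  degenerateExp μ y n = degenerateFalling y μ n * 1/ n !

  -- The left-hand side of the defining identity of S_{2,r}.
  stirling₂GF : Carrier → ℕ → ℕ → Series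
  stirling₂GF μ r k =
    1/ k ! • (degenerateExp μ (fromℕ r)
                ⊛ power (degenerateExp μ 1# ⊖ constant 1#) k)

  -- S₂ μ r n k is S_{2,r}(n+r, k+r | μ): the coefficient of tⁿ/n!, whence
  -- the factor n!.  The arguments n and k are not shifted by r.
  S₂ : Carrier → ℕ → ℕ → ℕ → Carrier
  S₂ μ r n k = fromℕ (n !) * stirling₂GF μ r k n

  -- The polynomial (x)_n, its variable being `indeterminate`.
  fallingPolynomial : ℕ → Series
  fallingPolynomial zero    = constant 1#
  fallingPolynomial (suc n) =
    fallingPolynomial n ⊛ (indeterminate ⊖ constant (fromℕ n))

  S₁ : ℕ → ℕ → Carrier
  S₁ n k = fallingPolynomial n k

  Δ : (Carrier → Carrier) → (Carrier → Carrier)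
  Δ f x = f (x + 1#) - f x

  Δ^ : ℕ → (Carrier → Carrier) → (Carrier → Carrier)
  Δ^ zero    f = f
  Δ^ (suc k) f = Δ (Δ^ k f)

open DegenerateStirling ℝ-commutativeRing fromℚᴿ fromℚᴿ-isRingHomomorphism public
  renaming (fromℕ to fromℕᴿ)

{-# OPTIONS --safe #-}
module Submission where

-- Write E x for the series (1+μt)^{x/μ}.  It is the solution of the differential
-- equation (1+μt)f′ = xf with constant term 1, and E x · E y satisfies the one
-- with x + y, so E (x + 1) = E x · E 1.  Hence Δ acts on x ↦ E x as multiplication
-- by E 1 - 1, and Δ^k E at r is the generating function of S_{2,r} up to the
-- factor 1/k!.  On the other hand the numbers S₁ expand the coefficients of E x in
-- powers of x, and Δ^k is linear.  For n < k the coefficient vanishes because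
-- E 1 - 1 has no constant term.

open import Algebra.Bundles using (CommutativeRing)
open import Algebra.Morphism.Structures using (IsRingHomomorphism)
import Algebra.Properties.Ring as RingProperties
import Algebra.Properties.Semiring.Mult as SemiringMult
import Algebra.Properties.CommutativeMonoid.Sum as CommutativeMonoidSum
import Algebra.Properties.Semiring.Sum as SemiringSum
import Algebra.Solver.Ring.NaturalCoefficients.Default as CommutativeSemiringSolver
open import Data.Fin.Properties using (toℕ≤pred[n])
import Data.Integer.Base as ℤ
import Data.Integer.Properties as ℤ
import Data.Nat.Properties as ℕ
import Data.Rational.Properties as ℚ
open import Data.Rational.Unnormalised.Base as ℚᵘ using (mkℚᵘ; *≡*)
import Data.Rational.Unnormalised.Properties as ℚᵘ
open import Function.Base using (_∘_)
open import Relation.Binary.PropositionalEquality.Core as ≡ using (_≡_)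
import Relation.Binary.Reasoning.Setoid as SetoidReasoning
open import Data.Nat.Base as ℕ using (ℕ; zero; suc; s≤s; _∸_; _<_; _≤_; _!; NonZero)
open import Data.Fin.Base using (Fin; toℕ)
open import Data.Product.Base using (_×_; _,_)
open import Data.Rational.Base as ℚ using (ℚ; 0ℚ; 1ℚ)
open import Defs using (module DegenerateStirling)

-- Integers and their reciprocals among the rationals.

[1+n]/1≡1+n/1 : ∀ n → (ℤ.+ suc n) ℚ./ 1 ≡ 1ℚ ℚ.+ (ℤ.+ n) ℚ./ 1
-- `ℚ._/_` normalises by a gcd; passing to unnormalised fractions avoids reasoning about it.
[1+n]/1≡1+n/1 n = ℚ.toℚᵘ-injective (begin
  ℚ.toℚᵘ ((ℤ.+ suc n) ℚ./ 1)           ≈⟨ ℚ.toℚᵘ-fromℚᵘ (mkℚᵘ (ℤ.+ suc n) 0) ⟩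
  mkℚᵘ (ℤ.+ suc n) 0                    ≈⟨ *≡* (≡.cong (λ i → (ℤ.1ℤ ℤ.+ i) ℤ.* ℤ.1ℤ) (≡.sym (ℤ.*-identityʳ (ℤ.+ n)))) ⟩
  ℚᵘ.1ℚᵘ ℚᵘ.+ mkℚᵘ (ℤ.+ n) 0            ≈⟨ ℚᵘ.+-congʳ ℚᵘ.1ℚᵘ (ℚ.toℚᵘ-fromℚᵘ (mkℚᵘ (ℤ.+ n) 0)) ⟨
  ℚᵘ.1ℚᵘ ℚᵘ.+ ℚ.toℚᵘ ((ℤ.+ n) ℚ./ 1)    ≈⟨ ℚ.toℚᵘ-homo-+ 1ℚ ((ℤ.+ n) ℚ./ 1) ⟨
  ℚ.toℚᵘ (1ℚ ℚ.+ (ℤ.+ n) ℚ./ 1)         ∎)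
  where open ℚᵘ.≃-Reasoning

n/1*1/n≡1 : ∀ n .{{_ : NonZero n}} → (ℤ.+ n) ℚ./ 1 ℚ.* ((ℤ.+ 1) ℚ./ n) ≡ 1ℚ
n/1*1/n≡1 (suc n) = ℚ.toℚᵘ-injective (begin
  ℚ.toℚᵘ ((ℤ.+ suc n) ℚ./ 1 ℚ.* (ℤ.1ℤ ℚ./ suc n))            ≈⟨ ℚ.toℚᵘ-homo-* ((ℤ.+ suc n) ℚ./ 1) (ℤ.1ℤ ℚ./ suc n) ⟩
  ℚ.toℚᵘ ((ℤ.+ suc n) ℚ./ 1) ℚᵘ.* ℚ.toℚᵘ (ℤ.1ℤ ℚ./ suc n)    ≈⟨ ℚᵘ.*-cong (ℚ.toℚᵘ-fromℚᵘ (mkℚᵘ (ℤ.+ suc n) 0)) (ℚ.toℚᵘ-fromℚᵘ (mkℚᵘ ℤ.1ℤ n)) ⟩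
  mkℚᵘ (ℤ.+ suc n) 0 ℚᵘ.* mkℚᵘ ℤ.1ℤ n                         ≈⟨ ℚᵘ.*-inverseʳ (mkℚᵘ (ℤ.+ suc n) 0) ⟩
  ℚᵘ.1ℚᵘ                                                       ∎)
  where open ℚᵘ.≃-Reasoning

module DegenerateStirlingProperties
  {c ℓ} (R : CommutativeRing c ℓ)
  (fromℚ : ℚ → CommutativeRing.Carrier R)
  (fromℚ-isRingHomomorphism :
    IsRingHomomorphism ℚ.+-*-rawRing (CommutativeRing.rawRing R) fromℚ)
  where

  open CommutativeRing R hiding (zero)
  open DegenerateStirling R fromℚ fromℚ-isRingHomomorphism
  open IsRingHomomorphism fromℚ-isRingHomomorphism
    using (0#-homo; 1#-homo; +-homo; *-homo)
  open RingProperties ring using (-0#≈0#; -1*x≈-x; -‿distribʳ-*; -‿+-comm; x[y-z]≈xy-xz)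
  open SemiringMult semiring using (×-homo-+; ×1-homo-*)
  open CommutativeMonoidSum +-commutativeMonoid using (∑-distrib-+)
  open SemiringSum semiring using (sum; sum-cong-≋; *-distribˡ-sum; sum-replicate-zero; sum-syntax)
  open CommutativeSemiringSolver commutativeSemiring using (solve; con; _:=_; _:+_; _:*_)
  open SetoidReasoning setoid

  -- Turns a factor of the degenerate falling factorial into the shape of a linear recurrence. The
  -- solver works in commutative semirings, so `- m` enters it as an atom.
  [x-nm]e≈xe-m[ne] : ∀ x n m e → (x - n * m) * e ≈ x * e + - m * (n * e)
  [x-nm]e≈xe-m[ne] x n m e = trans (*-congʳ (+-congˡ (-‿distribʳ-* n m)))
    (solve 4 (λ x n -m e → (x :+ n :* -m) :* e := x :* e :+ -m :* (n :* e)) refl x n (- m) e)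

  -- Factorials and their inverses as scalars.

  fromℕ≈fromℚ : ∀ n → fromℕ n ≈ fromℚ ((ℤ.+ n) ℚ./ 1)
  fromℕ≈fromℚ zero    = sym 0#-homo
  fromℕ≈fromℚ (suc n) = begin
    1# + fromℕ n                        ≈⟨ +-cong (sym 1#-homo) (fromℕ≈fromℚ n) ⟩
    fromℚ 1ℚ + fromℚ ((ℤ.+ n) ℚ./ 1)    ≈⟨ +-homo 1ℚ ((ℤ.+ n) ℚ./ 1) ⟨
    fromℚ (1ℚ ℚ.+ (ℤ.+ n) ℚ./ 1)        ≡⟨ ≡.cong fromℚ ([1+n]/1≡1+n/1 n) ⟨
    fromℚ ((ℤ.+ suc n) ℚ./ 1)           ∎

  -- `fromℕ` iterates addition in the ring, whereas `1/_!` is the image of a rational, so the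
  -- product is first moved into `ℚ`.
  n!*1/n!≈1 : ∀ n → fromℕ (n !) * 1/ n ! ≈ 1#
  n!*1/n!≈1 n = begin
    fromℕ (n !) * 1/ n !                      ≈⟨ *-congʳ (fromℕ≈fromℚ (n !)) ⟩
    fromℚ ((ℤ.+ (n !)) ℚ./ 1) * 1/ n !        ≈⟨ *-homo _ _ ⟨
    fromℚ ((ℤ.+ (n !)) ℚ./ 1 ℚ.* (ℤ.1ℤ ℚ./ (n !)))  ≡⟨ ≡.cong fromℚ (n/1*1/n≡1 (n !)) ⟩
    fromℚ 1ℚ                                  ≈⟨ 1#-homo ⟩
    1#                                        ∎
    where instance _ = n ℕ.!≢0

  -- Uniqueness of inverses: 1 is inserted as `n !` times its inverse, and then `suc n * n !`
  -- cancels against `1/ suc n !`.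
  1/[1+n]!*[1+n]≈1/n! : ∀ n → 1/ suc n ! * fromℕ (suc n) ≈ 1/ n !
  1/[1+n]!*[1+n]≈1/n! n = begin
    1/ suc n ! * fromℕ (suc n)
      ≈⟨ *-identityˡ _ ⟨
    1# * (1/ suc n ! * fromℕ (suc n))
      ≈⟨ *-congʳ (n!*1/n!≈1 n) ⟨
    fromℕ (n !) * 1/ n ! * (1/ suc n ! * fromℕ (suc n))
      ≈⟨ lemma (fromℕ (n !)) (1/ n !) (1/ suc n !) (fromℕ (suc n)) ⟩
    1/ n ! * (fromℕ (suc n) * fromℕ (n !) * 1/ suc n !)
      ≈⟨ *-congˡ (*-congʳ (×1-homo-* (suc n) (n !))) ⟨
    1/ n ! * (fromℕ (suc n !) * 1/ suc n !)
      ≈⟨ *-congˡ (n!*1/n!≈1 (suc n)) ⟩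
    1/ n ! * 1#
      ≈⟨ *-identityʳ _ ⟩
    1/ n ! ∎
    where
    lemma : ∀ a b c d → a * b * (c * d) ≈ b * (d * a * c)
    lemma = solve 4 (λ a b c d → a :* b :* (c :* d) := b :* (d :* a :* c)) refl

  -- Algebra of formal power series.

  shift : Series → Series
  shift f = f ∘ suc

  infix 4 _≋_
  _≋_ : Series → Series → Set ℓ
  f ≋ g = ∀ n → f n ≈ g n

  ⊛-cong : ∀ {f f′ g g′} → f ≋ f′ → g ≋ g′ → f ⊛ g ≋ f′ ⊛ g′
  ⊛-cong f≋ g≋ n = sum-cong-≋ {suc n} λ i → *-cong (f≋ (toℕ i)) (g≋ (n ∸ toℕ i))

  ⊛-distribˡ-+ : ∀ f g h n → (f ⊛ (λ i → g i + h i)) n ≈ (f ⊛ g) n + (f ⊛ h) n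
  ⊛-distribˡ-+ f g h n = trans
    (sum-cong-≋ {suc n} λ i → distribˡ (f (toℕ i)) (g (n ∸ toℕ i)) (h (n ∸ toℕ i)))
    (∑-distrib-+ {suc n} (λ i → f (toℕ i) * g (n ∸ toℕ i)) (λ i → f (toℕ i) * h (n ∸ toℕ i)))

  ⊛-distribʳ-+ : ∀ f g h n → ((λ i → g i + h i) ⊛ f) n ≈ (g ⊛ f) n + (h ⊛ f) n
  ⊛-distribʳ-+ f g h n = trans
    (sum-cong-≋ {suc n} λ i → distribʳ (f (n ∸ toℕ i)) (g (toℕ i)) (h (toℕ i)))
    (∑-distrib-+ {suc n} (λ i → g (toℕ i) * f (n ∸ toℕ i)) (λ i → h (toℕ i) * f (n ∸ toℕ i)))

  •-⊛ : ∀ a f g n → ((a • f) ⊛ g) n ≈ a * (f ⊛ g) n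
  •-⊛ a f g n = trans
    (sum-cong-≋ {suc n} λ i → *-assoc a (f (toℕ i)) (g (n ∸ toℕ i)))
    (sym (*-distribˡ-sum {suc n} a (λ i → f (toℕ i) * g (n ∸ toℕ i))))

  ⊛-• : ∀ a f g n → (f ⊛ (a • g)) n ≈ a * (f ⊛ g) n
  ⊛-• a f g n = trans
    (sum-cong-≋ {suc n} λ i → lemma (f (toℕ i)) a (g (n ∸ toℕ i)))
    (sym (*-distribˡ-sum {suc n} a (λ i → f (toℕ i) * g (n ∸ toℕ i))))
    where
    lemma : ∀ x y z → x * (y * z) ≈ y * (x * z)
    lemma = solve 3 (λ x y z → x :* (y :* z) := y :* (x :* z)) refl

  -- The sum in `⊛` unfolds at its first term; this is the mirror form, which splits off the last
  -- term. It follows by induction through `shift f`.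
  ⊛-sucʳ : ∀ f g n → (f ⊛ g) (suc n) ≈ (f ⊛ shift g) n + f (suc n) * g 0
  ⊛-sucʳ f g zero    = lemma (f 0 * g 1) (f 1 * g 0)
    where
    lemma : ∀ x y → x + (y + 0#) ≈ x + 0# + y
    lemma = solve 2 (λ x y → x :+ (y :+ con 0) := x :+ con 0 :+ y) refl
  ⊛-sucʳ f g (suc n) =
    trans (+-congˡ (⊛-sucʳ (shift f) g n)) (sym (+-assoc _ _ _))

  -- Induction on the index: `shift (f ⊛ g)` unfolds to `f 0 • shift g` plus `shift f ⊛ g`, so no
  -- double sum has to be interchanged.
  ⊛-assoc : ∀ f g h → (f ⊛ g) ⊛ h ≋ f ⊛ (g ⊛ h)
  ⊛-assoc f g h zero    = lemma (f 0) (g 0) (h 0)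
    where
    lemma : ∀ x y z → (x * y + 0#) * z + 0# ≈ x * (y * z + 0#) + 0#
    lemma = solve 3 (λ x y z → (x :* y :+ con 0) :* z :+ con 0 := x :* (y :* z :+ con 0) :+ con 0) refl
  ⊛-assoc f g h (suc n) = begin
    (f 0 * g 0 + 0#) * h (suc n) + (shift (f ⊛ g) ⊛ h) n
      ≈⟨ +-congˡ (⊛-distribʳ-+ h (f 0 • shift g) (shift f ⊛ g) n) ⟩
    (f 0 * g 0 + 0#) * h (suc n) + (((f 0 • shift g) ⊛ h) n + ((shift f ⊛ g) ⊛ h) n)
      ≈⟨ +-congˡ (+-cong (•-⊛ (f 0) (shift g) h n) (⊛-assoc (shift f) g h n)) ⟩
    (f 0 * g 0 + 0#) * h (suc n) + (f 0 * (shift g ⊛ h) n + (shift f ⊛ (g ⊛ h)) n)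
      ≈⟨ lemma (f 0) (g 0) (h (suc n)) _ _ ⟩
    f 0 * (g 0 * h (suc n) + (shift g ⊛ h) n) + (shift f ⊛ (g ⊛ h)) n ∎
    where
    lemma : ∀ x y z u v → (x * y + 0#) * z + (x * u + v) ≈ x * (y * z + u) + v
    lemma = solve 5 (λ x y z u v → (x :* y :+ con 0) :* z :+ (x :* u :+ v) := x :* (y :* z :+ u) :+ v) refl

  ⊛-constant : ∀ f a n → (f ⊛ constant a) n ≈ f n * a
  ⊛-constant f a zero    = +-identityʳ _
  ⊛-constant f a (suc n) = begin
    f 0 * 0# + (shift f ⊛ constant a) n  ≈⟨ +-cong (zeroʳ _) (⊛-constant (shift f) a n) ⟩
    0# + f (suc n) * a                   ≈⟨ +-identityˡ _ ⟩
    f (suc n) * a                        ∎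

  ⊛-negʳ : ∀ f g n → (f ⊛ (λ i → - g i)) n ≈ - (f ⊛ g) n
  ⊛-negʳ f g n = begin
    (f ⊛ (λ i → - g i)) n      ≈⟨ ⊛-cong {f} (λ _ → refl) (λ i → sym (-1*x≈-x (g i))) n ⟩
    (f ⊛ ((- 1#) • g)) n       ≈⟨ ⊛-• (- 1#) f g n ⟩
    (- 1#) * (f ⊛ g) n         ≈⟨ -1*x≈-x _ ⟩
    - (f ⊛ g) n                ∎

  ⊛-negˡ : ∀ f g n → ((λ i → - f i) ⊛ g) n ≈ - (f ⊛ g) n
  ⊛-negˡ f g n = begin
    ((λ i → - f i) ⊛ g) n      ≈⟨ ⊛-cong {g = g} (λ i → sym (-1*x≈-x (f i))) (λ _ → refl) n ⟩
    (((- 1#) • f) ⊛ g) n       ≈⟨ •-⊛ (- 1#) f g n ⟩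
    (- 1#) * (f ⊛ g) n         ≈⟨ -1*x≈-x _ ⟩
    - (f ⊛ g) n                ∎

  ⊛-⊖ : ∀ f g h n → (f ⊛ (g ⊖ h)) n ≈ (f ⊛ g) n - (f ⊛ h) n
  ⊛-⊖ f g h n = trans (⊛-distribˡ-+ f g (λ i → - h i) n) (+-congˡ (⊛-negʳ f h n))

  ⊖-⊛ : ∀ f g h n → ((g ⊖ h) ⊛ f) n ≈ (g ⊛ f) n - (h ⊛ f) n
  ⊖-⊛ f g h n = trans (⊛-distribʳ-+ f g (λ i → - h i) n) (+-congˡ (⊛-negˡ h f n))

  -- Vanishing of low coefficients.

  sum-zero : ∀ {n} (f : Fin n → Carrier) → (∀ i → f i ≈ 0#) → sum f ≈ 0#
  sum-zero {n} f f≈0 = trans (sum-cong-≋ f≈0) (sum-replicate-zero n)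

  ⊛-vanishing : ∀ {k} f g → (∀ {n} → n < k → g n ≈ 0#) →
    ∀ {n} → n < k → (f ⊛ g) n ≈ 0#
  ⊛-vanishing f g g≈0 {n} n<k = sum-zero {suc n} _ λ i →
    trans (*-congˡ {f (toℕ i)} (g≈0 (ℕ.≤-<-trans (ℕ.m∸n≤m n (toℕ i)) n<k))) (zeroʳ _)

  -- Such an `f` is t times `shift f`, so each factor of the power lowers the remaining degree by
  -- one.
  power-vanishing : ∀ {f} → f 0 ≈ 0# → ∀ k {n} → n < k → power f k n ≈ 0#
  power-vanishing {f} f₀≈0 (suc k) {zero}  _         = begin
    f 0 * power f k 0 + 0#    ≈⟨ +-identityʳ _ ⟩
    f 0 * power f k 0         ≈⟨ *-congʳ f₀≈0 ⟩
    0# * power f k 0          ≈⟨ zeroˡ _ ⟩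
    0#                        ∎
  power-vanishing {f} f₀≈0 (suc k) {suc n} (s≤s n<k) = begin
    f 0 * power f k (suc n) + (shift f ⊛ power f k) n
      ≈⟨ +-cong (*-congʳ f₀≈0) (⊛-vanishing (shift f) (power f k) (power-vanishing f₀≈0 k) n<k) ⟩
    0# * power f k (suc n) + 0#    ≈⟨ +-identityʳ _ ⟩
    0# * power f k (suc n)         ≈⟨ zeroˡ _ ⟩
    0#                             ∎

  -- The Euler operator t·d/dt.
  θ : Series → Series
  θ f n = fromℕ n * f n

  -- The Leibniz rule. Since `θ` does not shift indices, it holds term by term, from n = i + (n -
  -- i).
  θ-⊛ : ∀ f g n → θ (f ⊛ g) n ≈ (θ f ⊛ g) n + (f ⊛ θ g) n
  θ-⊛ f g n = begin
    fromℕ n * (f ⊛ g) n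
      ≈⟨ *-distribˡ-sum {suc n} (fromℕ n) (λ i → f (toℕ i) * g (n ∸ toℕ i)) ⟩
    ∑[ i ≤ n ] (fromℕ n * (f (toℕ i) * g (n ∸ toℕ i)))
      ≈⟨ sum-cong-≋ {suc n} term ⟩
    ∑[ i ≤ n ] (θ f (toℕ i) * g (n ∸ toℕ i) + f (toℕ i) * θ g (n ∸ toℕ i))
      ≈⟨ ∑-distrib-+ {suc n} (λ i → θ f (toℕ i) * g (n ∸ toℕ i)) (λ i → f (toℕ i) * θ g (n ∸ toℕ i)) ⟩
    (θ f ⊛ g) n + (f ⊛ θ g) n ∎
    where
    lemma : ∀ a b x y → (a + b) * (x * y) ≈ a * x * y + x * (b * y)
    lemma = solve 4 (λ a b x y → (a :+ b) :* (x :* y) := a :* x :* y :+ x :* (b :* y)) refl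
    term : ∀ (i : Fin (suc n)) → fromℕ n * (f (toℕ i) * g (n ∸ toℕ i)) ≈
      θ f (toℕ i) * g (n ∸ toℕ i) + f (toℕ i) * θ g (n ∸ toℕ i)
    term i = begin
      fromℕ n * (f (toℕ i) * g (n ∸ toℕ i))
        ≡⟨ ≡.cong (λ m → fromℕ m * (f (toℕ i) * g (n ∸ toℕ i))) (ℕ.m+[n∸m]≡n (toℕ≤pred[n] i)) ⟨
      fromℕ (toℕ i ℕ.+ (n ∸ toℕ i)) * (f (toℕ i) * g (n ∸ toℕ i))
        ≈⟨ *-congʳ (×-homo-+ 1# (toℕ i) (n ∸ toℕ i)) ⟩
      (fromℕ (toℕ i) + fromℕ (n ∸ toℕ i)) * (f (toℕ i) * g (n ∸ toℕ i))
        ≈⟨ lemma _ _ _ _ ⟩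
      θ f (toℕ i) * g (n ∸ toℕ i) + f (toℕ i) * θ g (n ∸ toℕ i) ∎

  -- The degenerate exponential and its differences.

  module _ (μ : Carrier) where

    E : Carrier → Series
    E = degenerateExp μ

    E₀≈1 : ∀ x → E x 0 ≈ 1#
    -- `fromℕ (0 !)` unfolds to `1# + 0#`.
    E₀≈1 x = trans (*-congʳ (sym (+-identityʳ 1#))) (n!*1/n!≈1 0)

    -- The differential equation (1+μt)f′ = xf, multiplied by t and read off at the coefficient of
    -- index `suc n`.
    θE-suc : ∀ x n → θ (E x) (suc n) ≈ x * E x n + - μ * θ (E x) n
    θE-suc x n = begin
      fromℕ (suc n) * (degenerateFalling x μ n * (x - fromℕ n * μ) * 1/ suc n !)
        ≈⟨ lemma _ _ _ _ ⟩
      (x - fromℕ n * μ) * (degenerateFalling x μ n * (1/ suc n ! * fromℕ (suc n)))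
        ≈⟨ *-congˡ (*-congˡ (1/[1+n]!*[1+n]≈1/n! n)) ⟩
      (x - fromℕ n * μ) * E x n
        ≈⟨ [x-nm]e≈xe-m[ne] _ _ _ _ ⟩
      x * E x n + - μ * (fromℕ n * E x n) ∎
      where
      lemma : ∀ a b c d → a * (b * c * d) ≈ c * (b * (d * a))
      lemma = solve 4 (λ a b c d → a :* (b :* c :* d) := c :* (b :* (d :* a))) refl

    -- By the Leibniz rule the equations of the two factors add up, which puts `x + y` in the place
    -- of the exponent.
    θ[Ex⊛Ey]-suc : ∀ x y n →
      θ (E x ⊛ E y) (suc n) ≈ (x + y - fromℕ n * μ) * (E x ⊛ E y) n
    θ[Ex⊛Ey]-suc x y n = begin
      θ (E x ⊛ E y) (suc n)
        ≈⟨ θ-⊛ (E x) (E y) (suc n) ⟩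
      (θ (E x) ⊛ E y) (suc n) + (E x ⊛ θ (E y)) (suc n)
        ≈⟨ +-cong left right ⟩
      (x * G + - μ * (θ (E x) ⊛ E y) n) + (y * G + - μ * (E x ⊛ θ (E y)) n)
        ≈⟨ lemma _ _ _ _ _ _ ⟩
      (x + y) * G + - μ * ((θ (E x) ⊛ E y) n + (E x ⊛ θ (E y)) n)
        ≈⟨ +-congˡ (*-congˡ (θ-⊛ (E x) (E y) n)) ⟨
      (x + y) * G + - μ * (fromℕ n * G)
        ≈⟨ [x-nm]e≈xe-m[ne] _ _ _ _ ⟨
      (x + y - fromℕ n * μ) * G ∎
      where
      G = (E x ⊛ E y) n
      lemma : ∀ x y m g a b → (x * g + m * a) + (y * g + m * b) ≈ (x + y) * g + m * (a + b)
      lemma = solve 6 (λ x y m g a b → (x :* g :+ m :* a) :+ (y :* g :+ m :* b) := (x :+ y) :* g :+ m :* (a :+ b)) refl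
      left : (θ (E x) ⊛ E y) (suc n) ≈ x * G + - μ * (θ (E x) ⊛ E y) n
      left = begin
        -- The first term drops out, because `θ (E x)` has no constant term.
        0# * E x 0 * E y (suc n) + (shift (θ (E x)) ⊛ E y) n
          ≈⟨ +-cong (trans (*-congʳ (zeroˡ _)) (zeroˡ _))
                    (⊛-cong {g = E y} (θE-suc x) (λ _ → refl) n) ⟩
        0# + ((λ i → x * E x i + - μ * θ (E x) i) ⊛ E y) n
          ≈⟨ +-identityˡ _ ⟩
        ((λ i → x * E x i + - μ * θ (E x) i) ⊛ E y) n
          ≈⟨ ⊛-distribʳ-+ (E y) (x • E x) (- μ • θ (E x)) n ⟩
        ((x • E x) ⊛ E y) n + ((- μ • θ (E x)) ⊛ E y) n
          ≈⟨ +-cong (•-⊛ x (E x) (E y) n) (•-⊛ (- μ) (θ (E x)) (E y) n) ⟩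
        x * G + - μ * (θ (E x) ⊛ E y) n ∎
      -- Now the vanishing term is the last one, so `⊛-sucʳ` replaces unfolding.
      right : (E x ⊛ θ (E y)) (suc n) ≈ y * G + - μ * (E x ⊛ θ (E y)) n
      right = begin
        (E x ⊛ θ (E y)) (suc n)
          ≈⟨ ⊛-sucʳ (E x) (θ (E y)) n ⟩
        (E x ⊛ shift (θ (E y))) n + E x (suc n) * (0# * E y 0)
          ≈⟨ +-cong (⊛-cong {E x} (λ _ → refl) (θE-suc y) n)
                    (trans (*-congˡ (zeroˡ _)) (zeroʳ _)) ⟩
        (E x ⊛ (λ i → y * E y i + - μ * θ (E y) i)) n + 0#
          ≈⟨ +-identityʳ _ ⟩
        (E x ⊛ (λ i → y * E y i + - μ * θ (E y) i)) n
          ≈⟨ ⊛-distribˡ-+ (E x) (y • E y) (- μ • θ (E y)) n ⟩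
        (E x ⊛ (y • E y)) n + (E x ⊛ (- μ • θ (E y))) n
          ≈⟨ +-cong (⊛-• y (E x) (E y) n) (⊛-• (- μ) (E x) (θ (E y)) n) ⟩
        y * G + - μ * (E x ⊛ θ (E y)) n ∎

    -- Scaled by `n !`, the recurrence for the product becomes the defining recursion of
    -- `degenerateFalling`, so plain induction identifies the two.
    n!*[Ex⊛Ey]≈falling : ∀ x y n →
      fromℕ (n !) * (E x ⊛ E y) n ≈ degenerateFalling (x + y) μ n
    n!*[Ex⊛Ey]≈falling x y zero    = begin
      (1# + 0#) * (E x 0 * E y 0 + 0#)  ≈⟨ *-cong (+-identityʳ 1#) (+-identityʳ _) ⟩
      1# * (E x 0 * E y 0)              ≈⟨ *-identityˡ _ ⟩
      E x 0 * E y 0                     ≈⟨ *-cong (E₀≈1 x) (E₀≈1 y) ⟩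
      1# * 1#                           ≈⟨ *-identityˡ _ ⟩
      1#                                ∎
    n!*[Ex⊛Ey]≈falling x y (suc n) = begin
      fromℕ (suc n !) * (E x ⊛ E y) (suc n)
        ≈⟨ *-congʳ (×1-homo-* (suc n) (n !)) ⟩
      fromℕ (suc n) * fromℕ (n !) * (E x ⊛ E y) (suc n)
        ≈⟨ lemma₁ _ _ _ ⟩
      fromℕ (n !) * θ (E x ⊛ E y) (suc n)
        ≈⟨ *-congˡ (θ[Ex⊛Ey]-suc x y n) ⟩
      fromℕ (n !) * ((x + y - fromℕ n * μ) * (E x ⊛ E y) n)
        ≈⟨ lemma₂ _ _ _ ⟩
      fromℕ (n !) * (E x ⊛ E y) n * (x + y - fromℕ n * μ)
        ≈⟨ *-congʳ (n!*[Ex⊛Ey]≈falling x y n) ⟩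
      degenerateFalling (x + y) μ (suc n) ∎
      where
      lemma₁ : ∀ a b c → a * b * c ≈ b * (a * c)
      lemma₁ = solve 3 (λ a b c → a :* b :* c := b :* (a :* c)) refl
      lemma₂ : ∀ a b c → a * (b * c) ≈ a * c * b
      lemma₂ = solve 3 (λ a b c → a :* (b :* c) := a :* c :* b) refl

    -- Coefficientwise, this is the Vandermonde convolution for degenerate falling factorials.
    degenerateExp-+ : ∀ x y → E (x + y) ≋ E x ⊛ E y
    degenerateExp-+ x y n = begin
      degenerateFalling (x + y) μ n * 1/ n !    ≈⟨ *-congʳ (n!*[Ex⊛Ey]≈falling x y n) ⟨
      fromℕ (n !) * (E x ⊛ E y) n * 1/ n !      ≈⟨ lemma _ _ _ ⟩
      (fromℕ (n !) * 1/ n !) * (E x ⊛ E y) n    ≈⟨ *-congʳ (n!*1/n!≈1 n) ⟩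
      1# * (E x ⊛ E y) n                        ≈⟨ *-identityˡ _ ⟩
      (E x ⊛ E y) n                             ∎
      where
      lemma : ∀ a b c → a * b * c ≈ a * c * b
      lemma = solve 3 (λ a b c → a :* b :* c := a :* c :* b) refl

    E₁⊖1 : Series
    E₁⊖1 = E 1# ⊖ constant 1#

    Δ-degenerateExp : ∀ x → E (x + 1#) ⊖ E x ≋ E x ⊛ E₁⊖1
    Δ-degenerateExp x n = begin
      E (x + 1#) n - E x n
        ≈⟨ +-cong (degenerateExp-+ x 1# n) (-‿cong (sym (trans (⊛-constant (E x) 1# n) (*-identityʳ _)))) ⟩
      (E x ⊛ E 1#) n - (E x ⊛ constant 1#) n
        ≈⟨ ⊛-⊖ (E x) (E 1#) (constant 1#) n ⟨
      (E x ⊛ E₁⊖1) n ∎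

    -- The outermost difference compares `Δ^ k` at `x + 1#` and at `x`, so the induction hypothesis
    -- is used at both points. The difference puts a factor `E₁⊖1` next to `E x`, and associativity
    -- moves it into the power.
    Δ^-degenerateExp : ∀ k n x → Δ^ k (λ y → E y n) x ≈ (E x ⊛ power E₁⊖1 k) n
    Δ^-degenerateExp zero    n x = sym (trans (⊛-constant (E x) 1# n) (*-identityʳ _))
    Δ^-degenerateExp (suc k) n x = begin
      Δ^ k (λ y → E y n) (x + 1#) - Δ^ k (λ y → E y n) x
        ≈⟨ +-cong (Δ^-degenerateExp k n (x + 1#)) (-‿cong (Δ^-degenerateExp k n x)) ⟩
      (E (x + 1#) ⊛ power E₁⊖1 k) n - (E x ⊛ power E₁⊖1 k) n
        ≈⟨ ⊖-⊛ (power E₁⊖1 k) (E (x + 1#)) (E x) n ⟨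
      ((E (x + 1#) ⊖ E x) ⊛ power E₁⊖1 k) n
        ≈⟨ ⊛-cong {g = power E₁⊖1 k} (Δ-degenerateExp x) (λ _ → refl) n ⟩
      ((E x ⊛ E₁⊖1) ⊛ power E₁⊖1 k) n
        ≈⟨ ⊛-assoc (E x) E₁⊖1 (power E₁⊖1 k) n ⟩
      (E x ⊛ power E₁⊖1 (suc k)) n ∎

    E₁⊖1-constantTerm : E₁⊖1 0 ≈ 0#
    E₁⊖1-constantTerm = trans (+-congʳ (E₀≈1 1#)) (-‿inverseʳ 1#)

    stirling₂GF-vanishing : ∀ r {n k} → n < k → stirling₂GF μ r k n ≈ 0#
    stirling₂GF-vanishing r {n} {k} n<k = trans
      (*-congˡ (⊛-vanishing (E (fromℕ r)) (power E₁⊖1 k) (power-vanishing E₁⊖1-constantTerm k) n<k))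
      (zeroʳ _)

    S₂-vanishing : ∀ r {n k} → n < k → S₂ μ r n k ≈ 0#
    S₂-vanishing r n<k = trans (*-congˡ (stirling₂GF-vanishing r n<k)) (zeroʳ _)

  -- Linearity of iterated differences.

  Δ^-cong : ∀ k {f g : Carrier → Carrier} → (∀ x → f x ≈ g x) → ∀ x → Δ^ k f x ≈ Δ^ k g x
  Δ^-cong zero    f≈g x = f≈g x
  Δ^-cong (suc k) f≈g x = +-cong (Δ^-cong k f≈g (x + 1#)) (-‿cong (Δ^-cong k f≈g x))

  Δ^-*ˡ : ∀ k a f x → Δ^ k (λ y → a * f y) x ≈ a * Δ^ k f x
  Δ^-*ˡ zero    a f x = refl
  Δ^-*ˡ (suc k) a f x = trans
    (+-cong (Δ^-*ˡ k a f (x + 1#)) (-‿cong (Δ^-*ˡ k a f x)))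
    (sym (x[y-z]≈xy-xz a _ _))

  Δ^-+ : ∀ k f g x → Δ^ k (λ y → f y + g y) x ≈ Δ^ k f x + Δ^ k g x
  Δ^-+ zero    f g x = refl
  Δ^-+ (suc k) f g x = trans
    (+-cong (Δ^-+ k f g (x + 1#)) (-‿cong (Δ^-+ k f g x)))
    (lemma _ _ _ _)
    where
    lemma : ∀ a b c d → (a + b) - (c + d) ≈ (a - c) + (b - d)
    lemma a b c d = trans (+-congˡ (sym (-‿+-comm c d)))
      (solve 4 (λ a b -c -d → (a :+ b) :+ (-c :+ -d) := (a :+ -c) :+ (b :+ -d)) refl a b (- c) (- d))

  Δ^-0 : ∀ k x → Δ^ k (λ _ → 0#) x ≈ 0#
  Δ^-0 zero    x = refl
  Δ^-0 (suc k) x = trans (+-cong (Δ^-0 k (x + 1#)) (-‿cong (Δ^-0 k x))) (-‿inverseʳ 0#)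

  Δ^-sum : ∀ k n (a : Fin n → Carrier) (f : Fin n → Carrier → Carrier) x →
    Δ^ k (λ y → ∑[ i < n ] (a i * f i y)) x ≈ ∑[ i < n ] (a i * Δ^ k (f i) x)
  Δ^-sum k zero    a f x = Δ^-0 k x
  Δ^-sum k (suc n) a f x = trans
    (Δ^-+ k (λ y → a Fin.zero * f Fin.zero y) _ x)
    (+-cong (Δ^-*ˡ k (a Fin.zero) (f Fin.zero) x) (Δ^-sum k n (a ∘ Fin.suc) (f ∘ Fin.suc) x))

  -- Stirling numbers of the first kind.

  ⊛[t⊖a]-zero : ∀ f a → (f ⊛ (indeterminate ⊖ constant a)) 0 ≈ - a * f 0
  ⊛[t⊖a]-zero f a = solve 2 (λ x -a → x :* (con 0 :+ -a) :+ con 0 := -a :* x) refl (f 0) (- a)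

  -- The shift of t - a is the constant 1, so splitting off the last term leaves just two. For
  -- `fallingPolynomial n` and `a = fromℕ n` this is the triangular recurrence of `S₁`.
  ⊛[t⊖a]-suc : ∀ f a n →
    (f ⊛ (indeterminate ⊖ constant a)) (suc n) ≈ f n + - a * f (suc n)
  ⊛[t⊖a]-suc f a n = begin
    (f ⊛ (indeterminate ⊖ constant a)) (suc n)
      ≈⟨ ⊛-sucʳ f (indeterminate ⊖ constant a) n ⟩
    (f ⊛ shift (indeterminate ⊖ constant a)) n + f (suc n) * (0# - a)
      ≈⟨ +-cong (⊛-cong {f} (λ _ → refl) shifted n) (*-congˡ (+-identityˡ (- a))) ⟩
    (f ⊛ constant 1#) n + f (suc n) * - a
      ≈⟨ +-cong (trans (⊛-constant f 1# n) (*-identityʳ _)) (*-comm _ _) ⟩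
    f n + - a * f (suc n) ∎
    where
    shifted : shift (indeterminate ⊖ constant a) ≋ constant 1#
    shifted zero    = trans (+-congˡ -0#≈0#) (+-identityʳ 1#)
    shifted (suc _) = -‿inverseʳ 0#

  S₁-vanishing : ∀ {n m} → n < m → S₁ n m ≈ 0#
  S₁-vanishing {zero}  {suc m} _         = refl
  S₁-vanishing {suc n} {suc m} (s≤s n<m) = begin
    S₁ (suc n) (suc m)                     ≈⟨ ⊛[t⊖a]-suc (fallingPolynomial n) (fromℕ n) m ⟩
    S₁ n m + - fromℕ n * S₁ n (suc m)      ≈⟨ +-cong (S₁-vanishing n<m) (*-congˡ (S₁-vanishing (ℕ.m<n⇒m<1+n n<m))) ⟩
    0# + - fromℕ n * 0#                    ≈⟨ +-identityˡ _ ⟩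
    - fromℕ n * 0#                         ≈⟨ zeroʳ _ ⟩
    0#                                     ∎

  -- As a convolution with the powers of μ, the sum obeys the same
  -- recursion in n as the degenerate falling factorial.
  S₁-convolution : ∀ μ x n →
    ((λ m → S₁ n m * x ^ m) ⊛ (μ ^_)) n ≈ degenerateFalling x μ n
  S₁-convolution μ x zero    = lemma
    where
    lemma : 1# * 1# * 1# + 0# ≈ 1#
    lemma = solve 0 (con 1 :* con 1 :* con 1 :+ con 0 := con 1) refl
  S₁-convolution μ x (suc n) = begin
    A (suc n) 0 * μ ^ suc n + (shift (A (suc n)) ⊛ (μ ^_)) n
      ≈⟨ +-cong (*-congʳ A-zero) (⊛-cong {g = μ ^_} A-suc (λ _ → refl) n) ⟩
    - fromℕ n * A n 0 * μ ^ suc n + ((λ m → x * A n m + - fromℕ n * A n (suc m)) ⊛ (μ ^_)) n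
      ≈⟨ +-congˡ (⊛-distribʳ-+ (μ ^_) (x • A n) (- fromℕ n • shift (A n)) n) ⟩
    - fromℕ n * A n 0 * μ ^ suc n + (((x • A n) ⊛ (μ ^_)) n + ((- fromℕ n • shift (A n)) ⊛ (μ ^_)) n)
      ≈⟨ +-congˡ (+-cong (•-⊛ x (A n) (μ ^_) n) (•-⊛ (- fromℕ n) (shift (A n)) (μ ^_) n)) ⟩
    - fromℕ n * A n 0 * μ ^ suc n + (x * H + - fromℕ n * (shift (A n) ⊛ (μ ^_)) n)
      -- The first and last summands combine into the convolution at `suc n`, unfolded at its first
      -- term.
      ≈⟨ lemma₁ _ _ _ _ _ ⟩
    x * H + - fromℕ n * (A n ⊛ (μ ^_)) (suc n)
      ≈⟨ +-congˡ (*-congˡ homogenise) ⟩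
    x * H + - fromℕ n * (μ * H)
      -- `μ` and `fromℕ n` exchange their usual roles, since here the minus sign sits on `fromℕ n`.
      ≈⟨ [x-nm]e≈xe-m[ne] x μ (fromℕ n) H ⟨
    (x - μ * fromℕ n) * H
      ≈⟨ *-comm _ _ ⟩
    H * (x - μ * fromℕ n)
      ≈⟨ *-cong (S₁-convolution μ x n) (+-congˡ (-‿cong (*-comm _ _))) ⟩
    degenerateFalling x μ (suc n) ∎
    where
    A : ℕ → Series
    A n m = S₁ n m * x ^ m
    H = (A n ⊛ (μ ^_)) n
    lemma₁ : ∀ a b c d e → a * b * c + (d + a * e) ≈ d + a * (b * c + e)
    lemma₁ = solve 5 (λ a b c d e → a :* b :* c :+ (d :+ a :* e) := d :+ a :* (b :* c :+ e)) refl
    lemma₃ : ∀ a b c x y → (a + b * c) * (x * y) ≈ x * (a * y) + b * (c * (x * y))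
    lemma₃ = solve 5 (λ a b c x y → (a :+ b :* c) :* (x :* y) := x :* (a :* y) :+ b :* (c :* (x :* y))) refl
    A-zero : A (suc n) 0 ≈ - fromℕ n * A n 0
    A-zero = trans (*-congʳ (⊛[t⊖a]-zero (fallingPolynomial n) (fromℕ n))) (*-assoc _ _ _)
    A-suc : ∀ m → A (suc n) (suc m) ≈ x * A n m + - fromℕ n * A n (suc m)
    A-suc m = trans (*-congʳ (⊛[t⊖a]-suc (fallingPolynomial n) (fromℕ n) m)) (lemma₃ _ _ _ _ _)
    -- `A n` vanishes beyond index n, so the top term disappears and every other term gains one
    -- factor `μ`.
    homogenise : (A n ⊛ (μ ^_)) (suc n) ≈ μ * H
    homogenise = begin
      (A n ⊛ (μ ^_)) (suc n)
        ≈⟨ ⊛-sucʳ (A n) (μ ^_) n ⟩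
      (A n ⊛ (μ • (μ ^_))) n + S₁ n (suc n) * x ^ suc n * 1#
        ≈⟨ +-cong (⊛-• μ (A n) (μ ^_) n) (*-congʳ (*-congʳ (S₁-vanishing (ℕ.n<1+n n)))) ⟩
      μ * H + 0# * x ^ suc n * 1#
        ≈⟨ +-congˡ (trans (*-identityʳ _) (zeroˡ _)) ⟩
      μ * H + 0#
        ≈⟨ +-identityʳ _ ⟩
      μ * H ∎

  S₁-sum : ∀ μ x n →
    ∑[ m ≤ n ] (μ ^ (n ∸ toℕ m) * S₁ n (toℕ m) * x ^ toℕ m) ≈ degenerateFalling x μ n
  S₁-sum μ x n = trans
    (sum-cong-≋ {suc n} λ m → trans (*-assoc (μ ^ (n ∸ toℕ m)) (S₁ n (toℕ m)) (x ^ toℕ m)) (*-comm _ _))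
    (S₁-convolution μ x n)

  -- The explicit formula.

  S₁-sum-Δ^ : ∀ μ x n k →
    ∑[ m ≤ n ] (μ ^ (n ∸ toℕ m) * S₁ n (toℕ m) * Δ^ k (_^ toℕ m) x)
      ≈ Δ^ k (λ y → degenerateFalling y μ n) x
  S₁-sum-Δ^ μ x n k = trans
    (sym (Δ^-sum k (suc n) (λ m → μ ^ (n ∸ toℕ m) * S₁ n (toℕ m)) (λ m → _^ toℕ m) x))
    (Δ^-cong k (λ y → S₁-sum μ y n) x)

  -- The bridge is `Δ^ k` of the degenerate falling factorial at `fromℕ r`. Written as `n !` times a
  -- coefficient of `degenerateExp`, it becomes a coefficient of the generating function of `S₂`.
  S₂-formula : ∀ μ r n k →
    1/ k ! * (∑[ m ≤ n ] (μ ^ (n ∸ toℕ m) * S₁ n (toℕ m) * Δ^ k (_^ toℕ m) (fromℕ r)))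
      ≈ S₂ μ r n k
  S₂-formula μ r n k = begin
    1/ k ! * (∑[ m ≤ n ] (μ ^ (n ∸ toℕ m) * S₁ n (toℕ m) * Δ^ k (_^ toℕ m) (fromℕ r)))
      ≈⟨ *-congˡ (S₁-sum-Δ^ μ (fromℕ r) n k) ⟩
    1/ k ! * Δ^ k (λ y → degenerateFalling y μ n) (fromℕ r)
      ≈⟨ *-congˡ (Δ^-cong k (λ y → sym (n!*E y)) (fromℕ r)) ⟩
    1/ k ! * Δ^ k (λ y → fromℕ (n !) * degenerateExp μ y n) (fromℕ r)
      ≈⟨ *-congˡ (Δ^-*ˡ k (fromℕ (n !)) (λ y → degenerateExp μ y n) (fromℕ r)) ⟩
    1/ k ! * (fromℕ (n !) * Δ^ k (λ y → degenerateExp μ y n) (fromℕ r))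
      ≈⟨ *-congˡ (*-congˡ (Δ^-degenerateExp μ k n (fromℕ r))) ⟩
    1/ k ! * (fromℕ (n !) * (degenerateExp μ (fromℕ r) ⊛ power (E₁⊖1 μ) k) n)
      ≈⟨ lemma _ _ _ ⟩
    S₂ μ r n k ∎
    where
    lemma : ∀ a b c → a * (b * c) ≈ b * (a * c)
    lemma = solve 3 (λ a b c → a :* (b :* c) := b :* (a :* c)) refl
    n!*E : ∀ y → fromℕ (n !) * degenerateExp μ y n ≈ degenerateFalling y μ n
    n!*E y = begin
      fromℕ (n !) * (degenerateFalling y μ n * 1/ n !)    ≈⟨ lemma _ _ _ ⟩
      degenerateFalling y μ n * (fromℕ (n !) * 1/ n !)    ≈⟨ *-congˡ (n!*1/n!≈1 n) ⟩
      degenerateFalling y μ n * 1#                        ≈⟨ *-identityʳ _ ⟩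
      degenerateFalling y μ n                             ∎

  -- The ingredients of the statement are arguments here, so that the type of
  -- an instance can be written with them verbatim.  Otherwise the instance at
  -- ℝ would be compared with its expected type by unfolding real numbers into
  -- Cauchy sequences together with their moduli, which is infeasible.
  explicitFormula :
    {_≈′_ : Carrier → Carrier → Set ℓ} {_*′_ : Carrier → Carrier → Carrier} {0′ : Carrier}
    {_^′_ : Carrier → ℕ → Carrier} {∑′ : ∀ n → (Fin (suc n) → Carrier) → Carrier}
    {fromℕ′ 1/′_! : ℕ → Carrier} {S₁′ : ℕ → ℕ → Carrier}
    {Δ^′ : ℕ → (Carrier → Carrier) → Carrier → Carrier}
    {S₂′ : Carrier → ℕ → ℕ → ℕ → Carrier} →
    _≈′_ ≡ _≈_ → _*′_ ≡ _*_ → 0′ ≡ 0# → _^′_ ≡ _^_ → ∑′ ≡ sum⁺-syntax →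
    fromℕ′ ≡ fromℕ → 1/′_! ≡ 1/_! → S₁′ ≡ S₁ → Δ^′ ≡ Δ^ → S₂′ ≡ S₂ →
    (μ : Carrier) (r n k : ℕ) →
    let lhs = 1/′ k ! *′ ∑′ n (λ m →
                ((μ ^′ (n ∸ toℕ m)) *′ S₁′ n (toℕ m)) *′ Δ^′ k (λ x → x ^′ toℕ m) (fromℕ′ r))
    in (n < k → lhs ≈′ 0′) × (k ≤ n → lhs ≈′ S₂′ μ r n k)
  explicitFormula ≡.refl ≡.refl ≡.refl ≡.refl ≡.refl ≡.refl ≡.refl ≡.refl ≡.refl ≡.refl μ r n k =
    (λ n<k → trans (S₂-formula μ r n k) (S₂-vanishing μ r n<k)) , (λ _ → S₂-formula μ r n k)

open import Defs

theorem2p4 : (μ : ℝ) (r n k : ℕ) →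
    let lhs = 1/ k ! *ᴿ (∑[ m ≤ n ] (μ ^ (n ∸ toℕ m) *ᴿ S₁ n (toℕ m) *ᴿ Δ^ k (λ x → x ^ toℕ m) (fromℕᴿ r)))
    in (n < k → lhs ≈ᴿ fromℚᴿ 0ℚ) × (k ≤ n → lhs ≈ᴿ S₂ μ r n k)
theorem2p4 = formula
  where
  open DegenerateStirlingProperties ℝ-commutativeRing fromℚᴿ fromℚᴿ-isRingHomomorphism
    using (explicitFormula)

  -- Agda elaborates names from an instantiated module differently in type
  -- signatures and in terms.  Passing these equations makes the type of `formula`
  -- contain them in the form that they have in a signature; `formula` itself has
  -- no signature so that its type is complete before it is compared.
  ^-refl : _^_ ≡ _^_
  ^-refl = ≡.refl
  ∑-refl : sum⁺-syntax ≡ sum⁺-syntax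
  ∑-refl = ≡.refl
  fromℕ-refl : fromℕᴿ ≡ fromℕᴿ
  fromℕ-refl = ≡.refl
  1/!-refl : 1/_! ≡ 1/_!
  1/!-refl = ≡.refl
  S₁-refl : S₁ ≡ S₁
  S₁-refl = ≡.refl
  Δ^-refl : Δ^ ≡ Δ^
  Δ^-refl = ≡.refl
  S₂-refl : S₂ ≡ S₂
  S₂-refl = ≡.refl

  formula = explicitFormula {_≈ᴿ_} {_*ᴿ_} {fromℚᴿ 0ℚ}
    ≡.refl ≡.refl ≡.refl ^-refl ∑-refl fromℕ-refl 1/!-refl S₁-refl Δ^-refl S₂-refl
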